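{- For $r \geq 2$, let $K_{n_1,n_2,\dots,n_r}$ be the complete multipartite graph with partite sets $V_1,V_2,\dots,V_r$, where $n_i = |V_i|$ and $n_1 \geq n_2 \geq \dots \geq n_r \geq 1$. Set $n = \sum_{i=1}^{r} n_i$. If the vertex $x$ lies in $V_i$, then \[ p_x(K_{n_1,n_2,\dots,n_r}) = \max\{ n - n_i,\, n_i - 1 \}. \] Thus $\mathrm{vp}(K_{n_1,n_2,\dots,n_r}) = n - n_r$.
   Context: All graphs are finite, undirected and simple. A $u,v$-geodesic is a shortest $u,v$-path. For a vertex $x$ of $G$, a set $S \subseteq V(G)$ is an $x$-position set if for every $y \in S$ no vertex of $S \setminus \{y\}$ lies on any $x,y$-geodesic in $G$. The $x$-position number $p_x(G)$ is the maximum cardinality of an $x$-position set of $G$. Define $\mathrm{vp}(G) = \max_{x \in V(G)} p_x(G)$. -}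

module Defs where

open import Level using (0ℓ)
open import Data.Nat using (ℕ; zero; suc; _≤_)
open import Data.Fin using (Fin)
open import Data.Fin.Subset using (Subset; _∈_; ∣_∣)
open import Data.List using (List; []; _∷_)
import Data.List.Membership.Propositional as List
open import Data.List.Relation.Unary.Unique.Propositional using (Unique)
open import Data.Product using (∃-syntax; _×_)
open import Function.Bundles using (_⇔_)
open import Relation.Binary.Construct.Closure.ReflexiveTransitive using (Star; ε; _◅_)
open import Relation.Binary.Core using (Rel)
open import Relation.Binary.Definitions using (Symmetric; Irreflexive)
open import Relation.Binary.PropositionalEquality using (_≡_; _≢_)
open import Relation.Nullary using (¬_)

record Graph (n : ℕ) : Set₁ where
  field
    Adj       : Rel (Fin n) 0ℓ
    symmetric : Symmetric Adj
    loopless  : Irreflexive _≡_ Adj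

module _ {n : ℕ} (G : Graph n) where
  open Graph G

  Walk : Fin n → Fin n → Set
  Walk = Star Adj

  vertices : ∀ {u v} → Walk u v → List (Fin n)
  vertices {u} ε       = u ∷ []
  vertices {u} (_ ◅ w) = u ∷ vertices w

  walkLength : ∀ {u v} → Walk u v → ℕ
  walkLength ε       = zero
  walkLength (_ ◅ w) = suc (walkLength w)

  IsPath : ∀ {u v} → Walk u v → Set
  IsPath w = Unique (vertices w)

  IsGeodesic : ∀ {u v} → Walk u v → Set
  IsGeodesic {u} {v} w =
    IsPath w × (∀ (w′ : Walk u v) → IsPath w′ → walkLength w ≤ walkLength w′)

  IsPositionSet : Fin n → Subset n → Set
  IsPositionSet x S =
    ∀ {y z} → y ∈ S → z ∈ S → z ≢ y →
    ∀ (w : Walk x y) → IsGeodesic w → ¬ (z List.∈ vertices w)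

IsMaximum : (ℕ → Set) → ℕ → Set
IsMaximum P m = P m × (∀ k → P k → k ≤ m)

-- Adjacency is not assumed decidable, so p_x and vp are single-valued
-- relations rather than functions: "p_x(G) = m" and "vp(G) = m".

IsPositionNumber : ∀ {n} → Graph n → Fin n → ℕ → Set
IsPositionNumber G x =
  IsMaximum (λ k → ∃[ S ] (IsPositionSet G x S × ∣ S ∣ ≡ k))

IsVertexPositionNumber : ∀ {n} → Graph n → ℕ → Set
IsVertexPositionNumber G =
  IsMaximum (λ k → ∃[ x ] IsPositionNumber G x k)

record IsCompleteMultipartite {n r : ℕ} (G : Graph n) (V : Fin r → Subset n) : Set where
  open Graph G
  field
    covering : ∀ v → ∃[ i ] v ∈ V i
    disjoint : ∀ {v i j} → v ∈ V i → v ∈ V j → i ≡ j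
    adjacent : ∀ {u v i j} → u ∈ V i → v ∈ V j → Adj u v ⇔ i ≢ j

{-# OPTIONS --safe #-}
-- Fix x in the part V i.  A vertex outside V i is joined to x by a geodesic of one edge,
-- and a vertex y ≠ x of V i exactly by the geodesics x, z, y with z outside V i.  So a
-- position set of x other than { x } avoids x and cannot meet both V i and its complement;
-- conversely ∁ (V i) and V i - x are position sets.
module Submission where

open import Defs
open import Data.Bool using (true; false)
open import Data.Nat using (ℕ; zero; suc; _+_; _∸_; _⊔_; _≥_; _≤_; z≤n; s≤s)
open import Data.Nat.Properties using (≤-trans; +-suc; m∸n≤m; ∸-monoʳ-≤;
  m≤m⊔n; m≤n⊔m; ⊔-lub; ⊔-sel; m≥n⇒m⊔n≡m; module ≤-Reasoning)
open import Data.Fin using (Fin; zero; suc; fromℕ; _≟_) renaming (_≤_ to _≤ᶠ_)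
open import Data.Fin.Properties using (suc-injective; ≤fromℕ)
open import Data.Fin.Subset using (Subset; _∈_; _∉_; _⊆_; ∣_∣; ∁; _∪_; _∩_; _-_; ⁅_⁆; ⋃; Nonempty)
open import Data.Fin.Subset.Properties using (_∈?_; nonempty?; Empty-unique; ∣⊥∣≡0; ∣⊤∣≡n; ∣⁅x⁆∣≡1; x∈⁅x⁆; x∈⁅y⁆⇒x≡y;
  ∉⊥; ⊆⊤; ⊆-antisym; p⊆q⇒∣p∣≤∣q∣; ∣∁p∣≡n∸∣p∣; x∈∁p⇒x∉p; x∉p⇒x∈∁p; x∈p∪q⁻; x∈p∪q⁺; x∈p∩q⁺; x∈p∩q⁻;
  p─⊥≡p; p─q⊆p; x∈p∧x≢y⇒x∈p-y; drop-there)
open import Data.List using (sum; tabulate)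
import Data.List.Membership.Propositional as List
open import Data.List.Relation.Unary.All using ([]; _∷_)
open import Data.List.Relation.Unary.AllPairs using ([]; _∷_)
open import Data.List.Relation.Unary.Any using (here; there)
open import Data.Product using (_×_; _,_; ∃-syntax; proj₁; proj₂)
open import Data.Sum using (inj₁; inj₂)
open import Data.Vec using (_∷_; []; here; there)
open import Function using (_∘_)
open import Function.Bundles using (Equivalence)
open import Relation.Binary.Construct.Closure.ReflexiveTransitive using (ε; _◅_)
open import Relation.Binary.PropositionalEquality using (_≡_; _≢_; refl; sym; trans; cong; subst)
open import Relation.Nullary using (¬_; yes; no; contradiction)

∣p∪q∣≡∣p∣+∣q∣ : ∀ {n} (p q : Subset n) → (∀ {x} → x ∈ p → x ∉ q) → ∣ p ∪ q ∣ ≡ ∣ p ∣ + ∣ q ∣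
∣p∪q∣≡∣p∣+∣q∣ []          []          p#q = refl
∣p∪q∣≡∣p∣+∣q∣ (true ∷ p)  (true ∷ q)  p#q = contradiction here (p#q here)
∣p∪q∣≡∣p∣+∣q∣ (true ∷ p)  (false ∷ q) p#q =
  cong suc (∣p∪q∣≡∣p∣+∣q∣ p q (λ a b → p#q (there a) (there b)))
∣p∪q∣≡∣p∣+∣q∣ (false ∷ p) (true ∷ q)  p#q =
  trans (cong suc (∣p∪q∣≡∣p∣+∣q∣ p q (λ a b → p#q (there a) (there b)))) (sym (+-suc ∣ p ∣ ∣ q ∣))
∣p∪q∣≡∣p∣+∣q∣ (false ∷ p) (false ∷ q) p#q =
  ∣p∪q∣≡∣p∣+∣q∣ p q (λ a b → p#q (there a) (there b))

∈⋃-tabulate⁺ : ∀ {n r} (V : Fin r → Subset n) {x} i → x ∈ V i → x ∈ ⋃ (tabulate V)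
∈⋃-tabulate⁺ V zero    x∈Vi = x∈p∪q⁺ (inj₁ x∈Vi)
∈⋃-tabulate⁺ V (suc i) x∈Vi = x∈p∪q⁺ (inj₂ (∈⋃-tabulate⁺ (V ∘ suc) i x∈Vi))

∈⋃-tabulate⁻ : ∀ {n r} (V : Fin r → Subset n) {x} → x ∈ ⋃ (tabulate V) → ∃[ i ] x ∈ V i
∈⋃-tabulate⁻ {r = zero}  V x∈ = contradiction x∈ ∉⊥
∈⋃-tabulate⁻ {r = suc _} V x∈ with x∈p∪q⁻ (V zero) _ x∈
... | inj₁ x∈V0 = zero , x∈V0
... | inj₂ x∈⋃ with ∈⋃-tabulate⁻ (V ∘ suc) x∈⋃
...   | i , x∈Vi = suc i , x∈Vi

∣⋃∣≡sum : ∀ {n r} (V : Fin r → Subset n) → (∀ {x i j} → x ∈ V i → x ∈ V j → i ≡ j) →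
          ∣ ⋃ (tabulate V) ∣ ≡ sum (tabulate (λ i → ∣ V i ∣))
∣⋃∣≡sum {n} {zero}  V disj = ∣⊥∣≡0 n
∣⋃∣≡sum {n} {suc r} V disj =
  trans (∣p∪q∣≡∣p∣+∣q∣ (V zero) _ V0#⋃)
        (cong (∣ V zero ∣ +_) (∣⋃∣≡sum (V ∘ suc) (λ a b → suc-injective (disj a b))))
  where
  V0#⋃ : ∀ {x} → x ∈ V zero → x ∉ ⋃ (tabulate (V ∘ suc))
  V0#⋃ x∈V0 x∈⋃ with ∈⋃-tabulate⁻ (V ∘ suc) x∈⋃
  ... | i , x∈Vi with disj x∈V0 x∈Vi
  ... | ()

-- The form with `suc` lets `cong (_∸ 1)` turn it into the size of `V i - x`.
∣p∣≡1+∣p-x∣ : ∀ {n} (p : Subset n) {x} → x ∈ p → ∣ p ∣ ≡ suc ∣ p - x ∣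
-- Removing the head leaves `p ─ ⊥` as the tail, since `⁅ zero ⁆` is `⊥` beyond its first entry.
∣p∣≡1+∣p-x∣ (true ∷ p)  here        = cong (suc ∘ ∣_∣) (sym (p─⊥≡p p))
∣p∣≡1+∣p-x∣ (true ∷ p)  (there x∈p) = cong suc (∣p∣≡1+∣p-x∣ p x∈p)
∣p∣≡1+∣p-x∣ (false ∷ p) (there x∈p) = ∣p∣≡1+∣p-x∣ p x∈p

x∉p-x : ∀ {n} (p : Subset n) x → x ∉ p - x
x∉p-x (true ∷ p)  zero ()
x∉p-x (false ∷ p) zero ()
x∉p-x (_ ∷ p) (suc x) x∈ = x∉p-x p x (drop-there x∈)

∣p∣≥1⇒nonempty : ∀ {n} (p : Subset n) → ∣ p ∣ ≥ 1 → Nonempty p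
∣p∣≥1⇒nonempty {n} p ∣p∣≥1 with nonempty? p
... | yes ne = ne
... | no  em with subst (_≥ 1) (trans (cong ∣_∣ (Empty-unique em)) (∣⊥∣≡0 n)) ∣p∣≥1
... | ()

module _ {n : ℕ} (G : Graph n) where
  open Graph G

  edge-isPath : ∀ {x y} (e : Adj x y) → IsPath G (e ◅ ε)
  edge-isPath e = ((λ x≡y → loopless x≡y e) ∷ []) ∷ [] ∷ []

  twoEdges-isPath : ∀ {x y z} → x ≢ y → (e : Adj x z) (f : Adj z y) → IsPath G (e ◅ f ◅ ε)
  twoEdges-isPath x≢y e f = ((λ x≡z → loopless x≡z e) ∷ x≢y ∷ []) ∷ edge-isPath f

  edge-isGeodesic : ∀ {x y} (e : Adj x y) → IsGeodesic G (e ◅ ε)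
  edge-isGeodesic {x} e = edge-isPath e , λ
    { ε       _ → contradiction e (loopless refl)
    ; (_ ◅ _) _ → s≤s z≤n }

  -- A shorter walk would be empty or a single edge, and the hypotheses rule out both. Hence every
  -- common neighbour `z` is the middle of a geodesic.
  twoEdges-isGeodesic : ∀ {x y z} → x ≢ y → ¬ Adj x y → (e : Adj x z) (f : Adj z y) →
                        IsGeodesic G (e ◅ f ◅ ε)
  twoEdges-isGeodesic x≢y x≁y e f = twoEdges-isPath x≢y e f , λ
    { ε           _ → contradiction refl x≢y
    ; (e ◅ ε)     _ → contradiction e x≁y
    ; (_ ◅ _ ◅ _) _ → s≤s (s≤s z≤n) }

  start∈vertices : ∀ {x y} (w : Walk G x y) → x List.∈ vertices G w
  start∈vertices ε       = here refl
  start∈vertices (_ ◅ _) = here refl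

-- `outsider` provides a middle vertex for geodesics between two vertices of one part, and makes
-- every complement nonempty.
module CompleteMultipartite {n r : ℕ} {G : Graph n} {V : Fin r → Subset n}
  (cm : IsCompleteMultipartite G V) (outsider : ∀ i → Nonempty (∁ (V i))) where
  open Graph G
  open IsCompleteMultipartite cm

  -- The theorem counts vertices by summing part sizes, whereas `∣ ∁ (V i) ∣` is computed from the
  -- size of the vertex type; this reconciles the two.
  sum∣V∣≡n : sum (tabulate (λ i → ∣ V i ∣)) ≡ n
  sum∣V∣≡n = trans (sym (∣⋃∣≡sum V disjoint))
    (trans (cong ∣_∣ (⊆-antisym ⊆⊤ (λ {x} _ → ∈⋃-tabulate⁺ V _ (proj₂ (covering x))))) (∣⊤∣≡n n))

  adjacent-across : ∀ {x y i} → x ∈ V i → y ∉ V i → Adj x y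
  adjacent-across {y = y} x∈ y∉ with covering y
  ... | j , y∈ = Equivalence.from (adjacent x∈ y∈) λ { refl → y∉ y∈ }

  nonadjacent-within : ∀ {x y i} → x ∈ V i → y ∈ V i → ¬ Adj x y
  nonadjacent-within x∈ y∈ e = Equivalence.to (adjacent x∈ y∈) e refl

  detour : ∀ {x y z i} → x ∈ V i → y ∈ V i → z ∉ V i → Walk G x y
  detour x∈ y∈ z∉ = adjacent-across x∈ z∉ ◅ symmetric (adjacent-across y∈ z∉) ◅ ε

  detour-isGeodesic : ∀ {x y z i} (x∈ : x ∈ V i) (y∈ : y ∈ V i) (z∉ : z ∉ V i) → x ≢ y →
                      IsGeodesic G (detour x∈ y∈ z∉)
  detour-isGeodesic x∈ y∈ z∉ x≢y = twoEdges-isGeodesic G x≢y (nonadjacent-within x∈ y∈)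
    (adjacent-across x∈ z∉) (symmetric (adjacent-across y∈ z∉))

  -- A position set is constrained only along geodesics that exist, so one to each `y` is needed to
  -- show that `x` shares a position set with no other vertex.
  geodesic : ∀ {x y} → x ≢ y → ∃[ w ] IsGeodesic G {x} {y} w
  geodesic {x} {y} x≢y with covering x
  ... | i , x∈ with y ∈? V i
  ...   | no  y∉ = adjacent-across x∈ y∉ ◅ ε , edge-isGeodesic G (adjacent-across x∈ y∉)
  ...   | yes y∈ = detour x∈ y∈ o∉ , detour-isGeodesic x∈ y∈ o∉ x≢y
    where o∉ = x∈∁p⇒x∉p (proj₂ (outsider i))

  -- Every vertex outside `V i` is adjacent to `x`, so a geodesic to it is an edge and has no
  -- interior vertex.
  ∁-isPositionSet : ∀ {x i} → x ∈ V i → IsPositionSet G x (∁ (V i))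
  ∁-isPositionSet x∈ y∈ z∈ z≢y ε           geo z∈w = x∈∁p⇒x∉p y∈ x∈
  ∁-isPositionSet x∈ y∈ z∈ z≢y (_ ◅ ε)     geo (here refl) = x∈∁p⇒x∉p z∈ x∈
  ∁-isPositionSet x∈ y∈ z∈ z≢y (_ ◅ ε)     geo (there (here z≡y)) = z≢y z≡y
  ∁-isPositionSet x∈ y∈ z∈ z≢y (_ ◅ _ ◅ _) (_ , shortest) z∈w
    with shortest (e ◅ ε) (edge-isPath G e)
    where e = adjacent-across x∈ (x∈∁p⇒x∉p y∈)
  ... | s≤s ()

  -- A geodesic from `x` to another vertex of `V i` has length two, and its middle vertex, being
  -- adjacent to `x`, lies outside `V i`.
  V-x-isPositionSet : ∀ {x i} → x ∈ V i → IsPositionSet G x (V i - x)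
  V-x-isPositionSet {x} {i} x∈ {y} {z} y∈′ z∈′ z≢y = avoids
    where
    y∈ : y ∈ V i
    y∈ = p─q⊆p (V i) ⁅ x ⁆ y∈′

    z∈ : z ∈ V i
    z∈ = p─q⊆p (V i) ⁅ x ⁆ z∈′

    x≢y : x ≢ y
    x≢y refl = x∉p-x (V i) x y∈′

    avoids : (w : Walk G x y) → IsGeodesic G w → ¬ (z List.∈ vertices G w)
    avoids ε           _ _ = x≢y refl
    avoids (e ◅ ε)     _ _ = nonadjacent-within x∈ y∈ e
    avoids (_ ◅ _ ◅ ε) _ (here refl) = x∉p-x (V i) x z∈′
    avoids (e ◅ _ ◅ ε) _ (there (here refl)) = nonadjacent-within x∈ z∈ e
    avoids (_ ◅ _ ◅ ε) _ (there (there (here z≡y))) = z≢y z≡y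
    avoids (_ ◅ _ ◅ _ ◅ _) (_ , shortest) _
      with shortest (detour x∈ y∈ o∉) (proj₁ (detour-isGeodesic x∈ y∈ o∉ x≢y))
      where o∉ = x∈∁p⇒x∉p (proj₂ (outsider i))
    ... | s≤s (s≤s ())

  -- Three cases: `S` contains `x` and is a singleton; or it misses `V i` and lies in the
  -- complement; or it meets `V i` and lies in `V i - x`.
  ∣positionSet∣≤ : ∀ {x i S} → x ∈ V i → IsPositionSet G x S →
                   ∣ S ∣ ≤ ∣ ∁ (V i) ∣ ⊔ (∣ V i ∣ ∸ 1)
  ∣positionSet∣≤ {x} {i} {S} x∈ pos with x ∈? S
  ... | yes x∈S = begin
    ∣ S ∣                          ≤⟨ p⊆q⇒∣p∣≤∣q∣ S⊆⁅x⁆ ⟩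
    -- If `V i` is just `x`, then `∣ V i ∣ ∸ 1` is zero, so the bound by one is taken from the
    -- complement, which contains `o`.
    ∣ ⁅ x ⁆ ∣                      ≡⟨ trans (∣⁅x⁆∣≡1 x) (sym (∣⁅x⁆∣≡1 o)) ⟩
    ∣ ⁅ o ⁆ ∣                      ≤⟨ p⊆q⇒∣p∣≤∣q∣ ⁅o⁆⊆∁ ⟩
    ∣ ∁ (V i) ∣                    ≤⟨ m≤m⊔n _ _ ⟩
    ∣ ∁ (V i) ∣ ⊔ (∣ V i ∣ ∸ 1)    ∎
    where
    open ≤-Reasoning
    o = proj₁ (outsider i)

    ⁅o⁆⊆∁ : ⁅ o ⁆ ⊆ ∁ (V i)
    ⁅o⁆⊆∁ v∈ rewrite x∈⁅y⁆⇒x≡y o v∈ = proj₂ (outsider i)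

    S⊆⁅x⁆ : S ⊆ ⁅ x ⁆
    S⊆⁅x⁆ {y} y∈S with x ≟ y
    ... | yes refl = x∈⁅x⁆ x
    ... | no  x≢y with geodesic x≢y
    ...   | w , geo = contradiction (start∈vertices G w) (pos y∈S x∈S x≢y w geo)
  ... | no x∉S with nonempty? (S ∩ V i)
  ...   | no  S∩V≡∅ = ≤-trans (p⊆q⇒∣p∣≤∣q∣ S⊆∁) (m≤m⊔n _ _)
    where
    S⊆∁ : S ⊆ ∁ (V i)
    S⊆∁ y∈S = x∉p⇒x∈∁p λ y∈V → S∩V≡∅ (_ , x∈p∩q⁺ (y∈S , y∈V))
  ...   | yes (y , y∈S∩V) = begin
    ∣ S ∣                          ≤⟨ p⊆q⇒∣p∣≤∣q∣ S⊆V-x ⟩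
    ∣ V i - x ∣                    ≡⟨ cong (_∸ 1) (∣p∣≡1+∣p-x∣ (V i) x∈) ⟨
    ∣ V i ∣ ∸ 1                    ≤⟨ m≤n⊔m ∣ ∁ (V i) ∣ _ ⟩
    ∣ ∁ (V i) ∣ ⊔ (∣ V i ∣ ∸ 1)    ∎
    where
    open ≤-Reasoning
    y∈S = proj₁ (x∈p∩q⁻ S (V i) y∈S∩V)
    y∈V = proj₂ (x∈p∩q⁻ S (V i) y∈S∩V)

    S⊆V-x : S ⊆ V i - x
    S⊆V-x {z} z∈S with z ∈? V i
    ... | yes z∈V = x∈p∧x≢y⇒x∈p-y z∈V λ { refl → x∉S z∈S }
    -- A vertex `z` of `S` outside `V i` would be the middle of the geodesic from `x` through `z` to
    -- `y`.
    ... | no  z∉V = contradiction (there (here refl))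
      (pos y∈S z∈S (λ { refl → z∉V y∈V }) (detour x∈ y∈V z∉V)
           (detour-isGeodesic x∈ y∈V z∉V λ { refl → x∉S y∈S }))

  isPositionNumber : ∀ {x i} → x ∈ V i → IsPositionNumber G x (∣ ∁ (V i) ∣ ⊔ (∣ V i ∣ ∸ 1))
  isPositionNumber {x} {i} x∈ = attained , λ { _ (_ , pos , refl) → ∣positionSet∣≤ x∈ pos }
    where
    attained : ∃[ S ] (IsPositionSet G x S × ∣ S ∣ ≡ ∣ ∁ (V i) ∣ ⊔ (∣ V i ∣ ∸ 1))
    attained with ⊔-sel ∣ ∁ (V i) ∣ (∣ V i ∣ ∸ 1)
    ... | inj₁ max≡ = ∁ (V i) , ∁-isPositionSet x∈ , sym max≡
    ... | inj₂ max≡ = V i - x , V-x-isPositionSet x∈ ,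
      trans (cong (_∸ 1) (sym (∣p∣≡1+∣p-x∣ (V i) x∈))) (sym max≡)

theorem3p3 : ∀ (k N : ℕ) (G : Graph N) (V : Fin (2 + k) → Subset N) →
    IsCompleteMultipartite G V →
    (∀ i j → i ≤ᶠ j → ∣ V i ∣ ≥ ∣ V j ∣) →
    ∣ V (fromℕ (suc k)) ∣ ≥ 1 →
    let n = sum (tabulate (λ i → ∣ V i ∣)) in
    (∀ i x → x ∈ V i → IsPositionNumber G x ((n ∸ ∣ V i ∣) ⊔ (∣ V i ∣ ∸ 1)))
    × IsVertexPositionNumber G (n ∸ ∣ V (fromℕ (suc k)) ∣)
theorem3p3 k N G V cm decreasing ∣Vᵣ∣≥1 = positionNumber , (attained , bounded)
  where
  open IsCompleteMultipartite cm
  r = fromℕ (suc k)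
  n = sum (tabulate (λ i → ∣ V i ∣))

  ∣Vᵣ∣≤ : ∀ i → ∣ V r ∣ ≤ ∣ V i ∣
  ∣Vᵣ∣≤ i = decreasing i r (≤fromℕ i)

  nonempty : ∀ i → Nonempty (V i)
  nonempty i = ∣p∣≥1⇒nonempty (V i) (≤-trans ∣Vᵣ∣≥1 (∣Vᵣ∣≤ i))

  disjoint⇒⊆∁ : ∀ {i j} → i ≢ j → V i ⊆ ∁ (V j)
  disjoint⇒⊆∁ i≢j x∈Vi = x∉p⇒x∈∁p λ x∈Vj → i≢j (disjoint x∈Vi x∈Vj)

  -- There are at least two parts: part zero borrows a vertex of part one, and every other part
  -- borrows one of part zero.
  outsider : ∀ i → Nonempty (∁ (V i))
  outsider zero    = _ , disjoint⇒⊆∁ {suc zero} (λ ()) (proj₂ (nonempty (suc zero)))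
  outsider (suc i) = _ , disjoint⇒⊆∁ {zero} (λ ()) (proj₂ (nonempty zero))

  open CompleteMultipartite cm outsider

  ∣∁V∣≡ : ∀ i → ∣ ∁ (V i) ∣ ≡ n ∸ ∣ V i ∣
  ∣∁V∣≡ i = trans (∣∁p∣≡n∸∣p∣ (V i)) (cong (_∸ ∣ V i ∣) (sym sum∣V∣≡n))

  positionNumber : ∀ i x → x ∈ V i → IsPositionNumber G x ((n ∸ ∣ V i ∣) ⊔ (∣ V i ∣ ∸ 1))
  positionNumber i x x∈ =
    subst (λ m → IsPositionNumber G x (m ⊔ (∣ V i ∣ ∸ 1))) (∣∁V∣≡ i) (isPositionNumber x∈)

  -- The largest part `V zero` differs from the last one, hence lies in its complement. This settles
  -- the second argument of the maximum for every part.
  ∣V∣∸1≤n∸∣Vᵣ∣ : ∀ i → ∣ V i ∣ ∸ 1 ≤ n ∸ ∣ V r ∣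
  ∣V∣∸1≤n∸∣Vᵣ∣ i = begin
    ∣ V i ∣ ∸ 1     ≤⟨ m∸n≤m ∣ V i ∣ 1 ⟩
    ∣ V i ∣         ≤⟨ decreasing zero i z≤n ⟩
    ∣ V zero ∣      ≤⟨ p⊆q⇒∣p∣≤∣q∣ (disjoint⇒⊆∁ {zero} {r} (λ ())) ⟩
    ∣ ∁ (V r) ∣     ≡⟨ ∣∁V∣≡ r ⟩
    n ∸ ∣ V r ∣     ∎
    where open ≤-Reasoning

  attained : ∃[ x ] IsPositionNumber G x (n ∸ ∣ V r ∣)
  attained with nonempty r
  -- For `x` in the last part the maximum collapses to its first argument.
  ... | x , x∈ = x , subst (IsPositionNumber G x) (m≥n⇒m⊔n≡m (∣V∣∸1≤n∸∣Vᵣ∣ r)) (positionNumber r x x∈)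

  bounded : ∀ m → ∃[ x ] IsPositionNumber G x m → m ≤ n ∸ ∣ V r ∣
  bounded m (x , (achieved , _)) with covering x
  -- As `m` is the size of a position set of `x`, it is at most the computed maximum, whose first
  -- argument is largest for the smallest part.
  ... | i , x∈ = ≤-trans (proj₂ (positionNumber i x x∈) m achieved)
                         (⊔-lub (∸-monoʳ-≤ n (∣Vᵣ∣≤ i)) (∣V∣∸1≤n∸∣Vᵣ∣ i))
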